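{- Let $D$ be an oriented graph missing $3$ disjoint stars whose centers form a directed triangle in $D$. If the dependency digraph $\Delta$ of $D$ has no isolated vertices, then $D$ satisfies the second neighborhood conjecture, that is, there is a vertex $v\in V(D)$ with $d^+_D(v)\le d^{++}_D(v)$.
   Context: All digraphs are finite. An oriented graph is a digraph without loops and without digons (directed cycles of length two). Write $x\rightarrow y$ if $(x,y)$ is an arc. $N^+(v)$ is the set of out-neighbors of $v$ and $N^{++}(v)$ is the set of vertices at distance exactly $2$ from $v$ (reached from $v$ by a directed path of length 2 but not by one of length 0 or 1); $d^+(v)=|N^+(v)|$, $d^{++}(v)=|N^{++}(v)|$. For distinct vertices $x,y$ of $D$, $xy$ is a missing edge if neither $(x,y)$ nor $(y,x)$ is an arc of $D$. The missing graph of $D$ is the graph whose edges are the missing edges of $D$ and whose vertices are the vertices of $D$ that are not adjacent to all other vertices. A star of center $x$ is a graph whose edge set has the form $\{a_ix : i=1,\dots,k\}$ with $k\ge 1$, the $a_i$ distinct and different from $x$ (when $k=1$, one of the two endpoints is designated as center). $D$ is missing 3 disjoint stars if its missing graph is the union of three pairwise vertex-disjoint stars. The centers $x,y,z$ of the stars form a directed triangle if the subdigraph of $D$ induced by $\{x,y,z\}$ is a directed cycle of length $3$. Dependency digraph: for missing edges $e$ and $e'$ of $D$, $e$ loses to $e'$ if the endpoints can be named $e=x_1y_1$, $e'=x_2y_2$ so that $x_1\rightarrow x_2$, $y_2\notin N^+(x_1)\cup N^{++}(x_1)$, $y_1\rightarrow y_2$ and $x_2\notin N^+(y_1)\cup N^{++}(y_1)$.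 The dependency digraph $\Delta$ of $D$ has the missing edges of $D$ as vertices, and an arc $(e,e')$ whenever $e$ loses to $e'$ (digons in $\Delta$ are allowed). A vertex of $\Delta$ is isolated if it has in-degree $0$ and out-degree $0$ in $\Delta$. -}

module Defs where

open import Level using (0ℓ)
open import Data.Nat.Base using (ℕ; _≤_)
open import Data.Fin.Base using (Fin; _<_)
open import Data.Fin.Properties using (_≟_; any?)
open import Data.Fin.Subset using (Subset; _∈_; _∉_; _∪_; ∣_∣; ⁅_⁆; Nonempty)
open import Data.Product.Base using (∃; ∃-syntax; _×_; _,_)
open import Data.Sum.Base using (_⊎_; inj₁; inj₂; swap; map)
open import Data.Vec.Base using (tabulate)
open import Function.Base using (_∘_)
open import Relation.Binary.Core using (Rel; _⇔_)
open import Relation.Binary.Definitions using (Irreflexive; Asymmetric; Symmetric)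
import Relation.Binary.Definitions as B
open import Relation.Binary.Construct.Union using () renaming (_∪_ to _∪ᴿ_)
open import Relation.Binary.PropositionalEquality.Core using (_≡_; _≢_; refl; sym; ≢-sym)
open import Relation.Nullary.Decidable.Core using (does; ¬?; _×-dec_)
open import Relation.Nullary.Negation.Core using (¬_)
open import Relation.Unary using (Pred; Decidable; _≐_; _⊥_) renaming (_∪_ to _∪ᴾ_)

subset : ∀ {n} {P : Pred (Fin n) 0ℓ} → Decidable P → Subset n
subset P? = tabulate (does ∘ P?)

record OrientedGraph (n : ℕ) : Set₁ where
  infix 4 _⟶_ _⟶?_
  field
    _⟶_     : Rel (Fin n) 0ℓ
    _⟶?_    : B.Decidable _⟶_
    noLoop  : Irreflexive _≡_ _⟶_
    noDigon : Asymmetric _⟶_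

  N⁺ : Fin n → Subset n
  N⁺ v = subset (v ⟶?_)

  AtDistance2 : Rel (Fin n) 0ℓ
  AtDistance2 v w = (∃[ u ] (v ⟶ u × u ⟶ w)) × v ≢ w × ¬ (v ⟶ w)

  atDistance2? : B.Decidable AtDistance2
  atDistance2? v w =
    any? (λ u → (v ⟶? u) ×-dec (u ⟶? w)) ×-dec ¬? (v ≟ w) ×-dec ¬? (v ⟶? w)

  N⁺⁺ : Fin n → Subset n
  N⁺⁺ v = subset (atDistance2? v)

  d⁺ d⁺⁺ : Fin n → ℕ
  d⁺ v = ∣ N⁺ v ∣
  d⁺⁺ v = ∣ N⁺⁺ v ∣

  Adjacent : Rel (Fin n) 0ℓ
  Adjacent x y = x ⟶ y ⊎ y ⟶ x

  MissingEdge : Rel (Fin n) 0ℓ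
  MissingEdge x y = x ≢ y × ¬ (x ⟶ y) × ¬ (y ⟶ x)

SatisfiesSNC : ∀ {n} → OrientedGraph n → Set
SatisfiesSNC D = ∃[ v ] d⁺ v ≤ d⁺⁺ v
  where open OrientedGraph D

-- Simple graphs whose vertex set is a subset of Fin n, so that graphs with
-- different vertex sets can be compared and united.
record Graph (n : ℕ) : Set₁ where
  field
    V        : Pred (Fin n) 0ℓ
    E        : Rel (Fin n) 0ℓ
    E-sym    : Symmetric E
    E-irrefl : Irreflexive _≡_ E
    E⇒V      : ∀ {x y} → E x y → V x

open Graph

infix  4 _≈ᴳ_
infixr 6 _∪ᴳ_

_≈ᴳ_ : ∀ {n} → Graph n → Graph n → Set
G ≈ᴳ H = V G ≐ V H × E G ⇔ E H

_∪ᴳ_ : ∀ {n} → Graph n → Graph n → Graph n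
G ∪ᴳ H = record
  { V        = V G ∪ᴾ V H
  ; E        = E G ∪ᴿ E H
  ; E-sym    = map (E-sym G) (E-sym H)
  ; E-irrefl = λ { p (inj₁ e) → E-irrefl G p e ; p (inj₂ e) → E-irrefl H p e }
  ; E⇒V      = map (E⇒V G) (E⇒V H)
  }

VertexDisjoint : ∀ {n} → Graph n → Graph n → Set
VertexDisjoint G H = V G ⊥ V H

-- An edge as an unordered pair: each pair is listed once, smaller endpoint
-- first.
record Edge {n} (G : Graph n) : Set where
  field
    lo hi : Fin n
    lo<hi : lo < hi
    edge  : E G lo hi

HasEndpoints : ∀ {n} {G : Graph n} → Edge G → Fin n → Fin n → Set
HasEndpoints e x y = (x ≡ lo × y ≡ hi) ⊎ (x ≡ hi × y ≡ lo)
  where open Edge e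

missingGraph : ∀ {n} → OrientedGraph n → Graph n
missingGraph {n} D = record
  { V        = λ v → ¬ (∀ w → v ≢ w → Adjacent v w)
  ; E        = MissingEdge
  ; E-sym    = λ (x≢y , x↛y , y↛x) → ≢-sym x≢y , y↛x , x↛y
  ; E-irrefl = λ x≡y (x≢y , _) → x≢y x≡y
  ; E⇒V      = λ (x≢y , x↛y , y↛x) adj → nonadjacent x↛y y↛x (adj _ x≢y)
  }
  where
  open OrientedGraph D
  nonadjacent : ∀ {x y} → ¬ (x ⟶ y) → ¬ (y ⟶ x) → ¬ Adjacent x y
  nonadjacent x↛y y↛x (inj₁ x⟶y) = x↛y x⟶y
  nonadjacent x↛y y↛x (inj₂ y⟶x) = y↛x y⟶x

-- The leaves are the vertices a₁, …, aₖ.  The centre is part of the data, so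
-- for k = 1 it records which endpoint is designated.
record Star (n : ℕ) : Set where
  field
    centre        : Fin n
    leaves        : Subset n
    nonempty      : Nonempty leaves
    centre∉leaves : centre ∉ leaves

  graph : Graph n
  graph = record
    { V        = λ v → v ≡ centre ⊎ v ∈ leaves
    ; E        = λ u v → (u ∈ leaves × v ≡ centre) ⊎ (v ∈ leaves × u ≡ centre)
    ; E-sym    = swap
    ; E-irrefl = λ { refl (inj₁ (c∈ , refl)) → centre∉leaves c∈
                   ; refl (inj₂ (c∈ , refl)) → centre∉leaves c∈ }
    ; E⇒V      = λ { (inj₁ (u∈ , _)) → inj₂ u∈ ; (inj₂ (_ , u≡c)) → inj₁ u≡c }
    }

open Star using (centre; graph)

record MissingDisjointStars {n} (D : OrientedGraph n) (S T U : Star n) : Set where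
  field
    S⊥T   : VertexDisjoint (graph S) (graph T)
    S⊥U   : VertexDisjoint (graph S) (graph U)
    T⊥U   : VertexDisjoint (graph T) (graph U)
    union : missingGraph D ≈ᴳ graph S ∪ᴳ graph T ∪ᴳ graph U

Induced : ∀ {n} → OrientedGraph n → Subset n → Rel (Fin n) 0ℓ
Induced D A u v = u ∈ A × v ∈ A × u ⟶ v
  where open OrientedGraph D

Cycle₃ : ∀ {n} (x y z : Fin n) → Rel (Fin n) 0ℓ
Cycle₃ x y z u v = (u ≡ x × v ≡ y) ⊎ (u ≡ y × v ≡ z) ⊎ (u ≡ z × v ≡ x)

-- The two alternatives are the two possible directions of the cycle.
DirectedTriangle : ∀ {n} → OrientedGraph n → (x y z : Fin n) → Set
DirectedTriangle D x y z =
  x ≢ y × x ≢ z × y ≢ z × (xyz ⇔ Cycle₃ x y z ⊎ xyz ⇔ Cycle₃ x z y)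
  where xyz = Induced D (⁅ x ⁆ ∪ ⁅ y ⁆ ∪ ⁅ z ⁆)

module _ {n} (D : OrientedGraph n) where
  open OrientedGraph D

  LosesTo : Rel (Edge (missingGraph D)) 0ℓ
  LosesTo e e′ = ∃[ x₁ ] ∃[ y₁ ] ∃[ x₂ ] ∃[ y₂ ]
      HasEndpoints e x₁ y₁ × HasEndpoints e′ x₂ y₂
    × x₁ ⟶ x₂ × y₂ ∉ N⁺ x₁ ∪ N⁺⁺ x₁
    × y₁ ⟶ y₂ × x₂ ∉ N⁺ y₁ ∪ N⁺⁺ y₁

  -- The dependency digraph, given by its arc relation on the missing edges.
  Δ : Rel (Edge (missingGraph D)) 0ℓ
  Δ = LosesTo

Isolated : {A : Set} → Rel A 0ℓ → Pred A 0ℓ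
Isolated _⟶_ v = (∀ u → ¬ (u ⟶ v)) × (∀ u → ¬ (v ⟶ u))

{-# OPTIONS --safe #-}

-- Write N[v] for the union of the first and second out-neighbourhoods of v.  Complete D to a
-- tournament ⇒ by orienting the missing edge between a centre s and a leaf l from s to l (a soft arc)
-- if every in-neighbour v of s has l in N[v], and from l to s otherwise.  Order the vertices so that
-- no vertex can be moved to the left in such a way that the number of forward arcs increases, or
-- stays equal while that of forward soft arcs decreases, and let f be the last vertex.  Call v a
-- pivot if v ∉ N[f]; in particular f is one.  If every out-neighbour of f in D is an out-neighbour
-- of every pivot in the tournament, then moving each pivot over the block between the previous pivot
-- and itself shows that f has at most as many first as second out-neighbours in the block.
-- The only exception is a pivot y which is the centre after x in the directed triangle, where f is a
-- leaf of the star with centre x.  Then y is counted as if it were in N[f].  The error of one is made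
-- up for in the block containing x, whose pivot v has v ⇒ x or a soft arc from x.

module Submission where

open import Defs
open import Level using (0ℓ)
open import Data.Empty using (⊥)
open import Data.Fin.Base using (Fin; zero; suc)
open import Data.Fin.Patterns using (0F; 1F; 2F)
open import Data.Fin.Properties using (_≟_; any?; all?; ¬∀⟶∃¬)
open import Data.Fin.Subset using (_∈_; ∣_∣)
open import Data.Fin.Subset.Properties using (_∈?_)
open import Data.List.Base using (List; []; _∷_; _++_; _∷ʳ_; map; length;
  tabulate; allFin; InitLast; initLast; _∷ʳ′_)
open import Data.List.Properties using (map-tabulate; map-++; ++-assoc; length-tabulate; length-++)
open import Data.List.Membership.Propositional.Properties using (∈-allFin)
open import Data.List.Relation.Binary.Permutation.Propositional using (_↭_; ↭-refl; ↭-sym; ↭-trans)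
open import Data.List.Relation.Binary.Permutation.Propositional.Properties
  using (map⁺; ∈-resp-↭; ↭-length; ++⁺ˡ; shift)
open import Data.List.Relation.Unary.All using (All; []; _∷_)
open import Data.List.Relation.Unary.All.Properties using () renaming (++⁺ to All-++⁺)
open import Data.Nat.Base using (ℕ; zero; suc; _+_; _*_; _≤_; _<_; z≤n; s≤s)
open import Data.Nat.Induction using (<-rec)
open import Data.Nat.ListAction using (sum)
open import Data.Nat.ListAction.Properties using (sum-++; sum-↭)
open import Data.Nat.Properties hiding (_≟_)
open import Data.Nat.Tactic.RingSolver using (solve-∀)
open import Data.Product.Base using (_×_; _,_; proj₁; proj₂; ∃-syntax)
open import Data.Sum.Base using (_⊎_; inj₁; inj₂; [_,_]′)
open import Function.Base using (_∘_; flip; id)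
open import Relation.Binary.Core using (Rel)
open import Relation.Binary.Definitions using () renaming (Decidable to Decidable₂)
open import Relation.Binary.PropositionalEquality using (_≡_; _≢_; refl; sym;
  ≢-sym; trans; cong; cong₂; subst; subst₂)
open import Relation.Nullary.Decidable using (Dec; yes; no; _×-dec_; _⊎-dec_;
  _→-dec_; ¬?; decidable-stable; from-yes)
open import Relation.Nullary.Negation using (¬_; contradiction)
open import Relation.Unary using (Pred; Decidable)

-- Indicators and finite sums.

𝟙 : {P : Set} → Dec P → ℕ
𝟙 (yes _) = 1
𝟙 (no _)  = 0

𝟙≤1 : {P : Set} (p : Dec P) → 𝟙 p ≤ 1
𝟙≤1 (yes _) = ≤-refl
𝟙≤1 (no _)  = z≤n

𝟙-yes : {P : Set} (p : Dec P) → P → 1 ≤ 𝟙 p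
𝟙-yes (yes _) _ = ≤-refl
𝟙-yes (no ¬p) p = contradiction p ¬p

𝟙-no : {P : Set} (p : Dec P) → ¬ P → 𝟙 p ≡ 0
𝟙-no (yes p) ¬p = contradiction p ¬p
𝟙-no (no _)  _  = refl

𝟙-mono : {P Q : Set} (p : Dec P) (q : Dec Q) → (P → Q) → 𝟙 p ≤ 𝟙 q
𝟙-mono (yes p) q f = 𝟙-yes q (f p)
𝟙-mono (no _)  q f = z≤n

𝟙-exclusive : {P Q : Set} (p : Dec P) (q : Dec Q) → (P → ¬ Q) → 𝟙 p + 𝟙 q ≤ 1
𝟙-exclusive (yes p) (yes q) f = contradiction q (f p)
𝟙-exclusive (yes _) (no _)  f = ≤-refl
𝟙-exclusive (no _)  q       f = 𝟙≤1 q

𝟙-exclusive-mono : {P Q R : Set} (p : Dec P) (q : Dec Q) (r : Dec R) →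
  (P → R) → (Q → R) → (P → ¬ Q) → 𝟙 p + 𝟙 q ≤ 𝟙 r
𝟙-exclusive-mono p q (yes _) _ _ p→¬q = 𝟙-exclusive p q p→¬q
𝟙-exclusive-mono p q (no ¬r) p→r q→r _ =
  ≤-reflexive (cong₂ _+_ (𝟙-no p (¬r ∘ p→r)) (𝟙-no q (¬r ∘ q→r)))

Σ[_] : {A : Set} → (A → ℕ) → List A → ℕ
Σ[ f ] = sum ∘ map f

module _ {A : Set} where

  Σ-++ : (f : A → ℕ) (xs ys : List A) → Σ[ f ] (xs ++ ys) ≡ Σ[ f ] xs + Σ[ f ] ys
  Σ-++ f xs ys = trans (cong sum (map-++ f xs ys)) (sum-++ (map f xs) (map f ys))

  Σ-↭ : (f : A → ℕ) {xs ys : List A} → xs ↭ ys → Σ[ f ] xs ≡ Σ[ f ] ys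
  Σ-↭ f = sum-↭ ∘ map⁺ f

  Σ-mono : {f g : A → ℕ} (xs : List A) → (∀ x → f x ≤ g x) → Σ[ f ] xs ≤ Σ[ g ] xs
  Σ-mono []       f≤g = z≤n
  Σ-mono (x ∷ xs) f≤g = +-mono-≤ (f≤g x) (Σ-mono xs f≤g)

  Σ-+ : (f g : A → ℕ) (xs : List A) → Σ[ (λ x → f x + g x) ] xs ≡ Σ[ f ] xs + Σ[ g ] xs
  Σ-+ f g []       = refl
  Σ-+ f g (x ∷ xs) = trans (cong (f x + g x +_) (Σ-+ f g xs)) (interchange (f x) (g x) _ _)
    where
    interchange : ∀ a b c d → a + b + (c + d) ≡ a + c + (b + d)
    interchange = solve-∀

  Σ-* : (k : ℕ) (f : A → ℕ) (xs : List A) → Σ[ (λ x → k * f x) ] xs ≡ k * Σ[ f ] xs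
  Σ-* k f []       = sym (*-zeroʳ k)
  Σ-* k f (x ∷ xs) = trans (cong (k * f x +_) (Σ-* k f xs)) (sym (*-distribˡ-+ k (f x) _))

  Σ-≤length : {f : A → ℕ} (xs : List A) → (∀ x → f x ≤ 1) → Σ[ f ] xs ≤ length xs
  Σ-≤length []       f≤1 = z≤n
  Σ-≤length (x ∷ xs) f≤1 = +-mono-≤ (f≤1 x) (Σ-≤length xs f≤1)

-- Turns degrees into sums over the list of vertices, which can then be reordered and cut into
-- blocks.
∣subset∣ : ∀ {n} {P : Pred (Fin n) 0ℓ} (P? : Decidable P) →
  ∣ subset P? ∣ ≡ Σ[ (λ i → 𝟙 (P? i)) ] (allFin n)
∣subset∣ {n} P? = trans (count-tabulate P?) (cong sum (sym (map-tabulate id (λ i → 𝟙 (P? i)))))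
  where
  count-tabulate : ∀ {n} {P : Pred (Fin n) 0ℓ} (P? : Decidable P) →
    ∣ subset P? ∣ ≡ sum (tabulate (λ i → 𝟙 (P? i)))
  count-tabulate {zero}  P? = refl
  count-tabulate {suc n} P? with P? zero
  ... | yes _ = cong suc (count-tabulate (P? ∘ suc))
  ... | no  _ = count-tabulate (P? ∘ suc)

Σ-indicator : ∀ {n} (x : Fin n) → Σ[ (λ i → 𝟙 (x ≟ i)) ] (allFin n) ≡ 1
Σ-indicator {n} x = trans (sym (∣subset∣ (x ≟_))) (singleton x)
  where
  none : ∀ m {k} (f : Fin m → Fin k) → ∣ subset (λ i → zero ≟ suc (f i)) ∣ ≡ 0
  none zero    f = refl
  none (suc m) f = none m (f ∘ suc)

  suc≟suc : ∀ {n} m (x : Fin n) (f : Fin m → Fin n) →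
    ∣ subset (λ i → suc x ≟ suc (f i)) ∣ ≡ ∣ subset (λ i → x ≟ f i) ∣
  suc≟suc zero    x f = refl
  suc≟suc (suc m) x f with x ≟ f zero
  ... | yes _ = cong suc (suc≟suc m x (f ∘ suc))
  ... | no  _ = suc≟suc m x (f ∘ suc)

  singleton : ∀ {n} (x : Fin n) → ∣ subset (x ≟_) ∣ ≡ 1
  singleton {suc n} zero    = cong suc (none n id)
  singleton {suc n} (suc x) = trans (suc≟suc n x id) (singleton x)

-- Local median orders.

module MedianOrder {A : Set} (w : A → A → ℕ) where

  LocallyMedian : List A → Set
  LocallyMedian L = ∀ P B v Q → P ++ B ++ v ∷ Q ≡ L → Σ[ w v ] B ≤ Σ[ flip w v ] B

  -- Complementary to the forward weight: an improving move lowers it, so that descent in `ℕ`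
  -- replaces maximisation.
  backward : List A → ℕ
  backward []      = 0
  backward (u ∷ L) = Σ[ flip w u ] L + backward L

  private
    move-↭ : ∀ P B (v : A) Q → P ++ v ∷ B ++ Q ↭ P ++ B ++ v ∷ Q
    move-↭ P B v Q = ++⁺ˡ P (↭-sym (shift v B Q))

    -- Only the pairs formed by `v` and a member of `B` change their order. Adding a term on each
    -- side avoids subtraction.
    backward-move : ∀ P B v Q →
      backward (P ++ v ∷ B ++ Q) + Σ[ w v ] B ≡ backward (P ++ B ++ v ∷ Q) + Σ[ flip w v ] B
    backward-move (p ∷ P) B v Q =
      -- What `p` contributes does not depend on the order of the vertices after it.
      trans (cong (λ k → k + backward (P ++ v ∷ B ++ Q) + Σ[ w v ] B)
              (Σ-↭ (flip w p) (move-↭ P B v Q)))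
        (trans (+-assoc Σp _ _)
          (trans (cong (Σp +_) (backward-move P B v Q)) (sym (+-assoc Σp _ _))))
      where Σp = Σ[ flip w p ] (P ++ B ++ v ∷ Q)
    backward-move [] [] v Q = refl
    backward-move [] (b ∷ B) v Q =
      trans
        (rearrange (w b v) (Σ[ flip w v ] (B ++ Q)) (Σ[ flip w b ] (B ++ Q)) _ _ _ (w v b) _
          (backward-move [] B v Q))
        (cong (λ k → k + backward (B ++ v ∷ Q) + (w b v + Σ[ flip w v ] B))
          (Σ-↭ (flip w b) (move-↭ [] B v Q)))
      where
      left : ∀ bv s t k vb o → (bv + s) + (t + k) + (vb + o) ≡ ((s + k) + o) + (bv + t + vb)
      left = solve-∀
      right : ∀ bv t k′ vb i → (vb + t) + k′ + (bv + i) ≡ (k′ + i) + (bv + t + vb)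
      right = solve-∀
      rearrange : ∀ bv s t k k′ o vb i → s + k + o ≡ k′ + i →
        (bv + s) + (t + k) + (vb + o) ≡ (vb + t) + k′ + (bv + i)
      rearrange bv s t k k′ o vb i eq =
        trans (left bv s t k vb o) (trans (cong (_+ (bv + t + vb)) eq) (sym (right bv t k′ vb i)))

  -- Sufficient for proving decidable statements; it spares the search for an optimal order.
  ¬¬locallyMedian : ∀ L → ¬ ¬ (∃[ L′ ] (L′ ↭ L × LocallyMedian L′))
  ¬¬locallyMedian L none = <-rec Hopeless step (backward L) L ↭-refl refl
    where
    Hopeless : ℕ → Set
    Hopeless k = ∀ L′ → L′ ↭ L → backward L′ ≡ k → ⊥

    step : ∀ k → (∀ {j} → j < k → Hopeless j) → Hopeless k
    step _ rec L′ L′↭L refl = none (L′ , L′↭L , locallyMedian)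
      where
      locallyMedian : LocallyMedian L′
      locallyMedian P B v Q refl = ≮⇒≥ λ gain →
        -- By `backward-move`, what the move gains is what `backward` loses, so the induction
        -- hypothesis applies to the new order.
        rec (+-cancelʳ-< _ _ _
              (subst (_< backward L′ + Σ[ w v ] B) (sym (backward-move P B v Q))
                (+-monoʳ-< (backward L′) gain)))
          (P ++ v ∷ B ++ Q) (↭-trans (move-↭ P B v Q) L′↭L) refl

-- A list ending in a pivot splits into blocks without pivots, each followed by a pivot.
module _ {A : Set} {Pivot : Pred A 0ℓ} (Pivot? : Decidable Pivot) (h m : A → ℕ)
  (h-pivot : ∀ v → Pivot v → h v ≡ 0) (m-nonpivot : ∀ u → ¬ Pivot u → 1 ≤ m u) where

  Σ-blocks : ∀ L f → Pivot f →
    (∀ P B v Q → P ++ B ++ v ∷ Q ≡ L ∷ʳ f → Pivot v → Σ[ h ] B ≤ length B) →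
    Σ[ h ] (L ∷ʳ f) ≤ Σ[ m ] (L ∷ʳ f)
  Σ-blocks L f pf block = go [] [] [] L refl
    where
    open ≤-Reasoning

    m-block : ∀ B → All (¬_ ∘ Pivot) B → length B ≤ Σ[ m ] B
    m-block []      []         = z≤n
    m-block (u ∷ B) (¬pu ∷ ¬p) = +-mono-≤ (m-nonpivot u ¬pu) (m-block B ¬p)

    close : ∀ P B v Q → P ++ B ++ v ∷ Q ≡ L ∷ʳ f → Pivot v → All (¬_ ∘ Pivot) B →
      Σ[ h ] Q ≤ Σ[ m ] Q → Σ[ h ] (B ++ v ∷ Q) ≤ Σ[ m ] (B ++ v ∷ Q)
    close P B v Q eq pv ¬p rest = begin
      Σ[ h ] (B ++ v ∷ Q)          ≡⟨ Σ-++ h B (v ∷ Q) ⟩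
      Σ[ h ] B + (h v + Σ[ h ] Q)  ≡⟨ cong (λ k → Σ[ h ] B + (k + Σ[ h ] Q)) (h-pivot v pv) ⟩
      -- The length of `B` stands between the two sums: `m` is at least 1 throughout `B`, which
      -- contains no pivot.
      Σ[ h ] B + Σ[ h ] Q          ≤⟨ +-mono-≤ (≤-trans (block P B v Q eq pv) (m-block B ¬p))
                                        (≤-trans rest (m≤n+m _ (m v))) ⟩
      Σ[ m ] B + Σ[ m ] (v ∷ Q)    ≡⟨ Σ-++ m B (v ∷ Q) ⟨
      Σ[ m ] (B ++ v ∷ Q)          ∎

    -- `P` holds the blocks already closed, `B` the open block, and `R ∷ʳ f` what is still to be
    -- scanned; `f` closes the last block.
    go : ∀ P B → All (¬_ ∘ Pivot) B → ∀ R → P ++ B ++ R ∷ʳ f ≡ L ∷ʳ f →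
      Σ[ h ] (B ++ R ∷ʳ f) ≤ Σ[ m ] (B ++ R ∷ʳ f)
    go P B ¬p [] eq = close P B f [] eq pf ¬p z≤n
    go P B ¬p (u ∷ R) eq with Pivot? u
    ... | yes pu = close P B u (R ∷ʳ f) eq pu ¬p
          (go (P ++ B ++ u ∷ []) [] [] R
            (trans (++-assoc P (B ++ u ∷ []) (R ∷ʳ f))
              (trans (cong (P ++_) (++-assoc B (u ∷ []) (R ∷ʳ f))) eq)))
    ... | no ¬pu = subst (λ K → Σ[ h ] K ≤ Σ[ m ] K) (++-assoc B (u ∷ []) (R ∷ʳ f))
          (go P (B ++ u ∷ []) (All-++⁺ ¬p (¬pu ∷ [])) R
            (trans (cong (P ++_) (++-assoc B (u ∷ []) (R ∷ʳ f))) eq))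

-- Second neighbourhoods and missing stars.

module _ {n} (D : OrientedGraph n) where
  open OrientedGraph D

  Reaches : Rel (Fin n) 0ℓ
  Reaches v w = v ⟶ w ⊎ AtDistance2 v w

  reaches? : Decidable₂ Reaches
  reaches? v w = (v ⟶? w) ⊎-dec atDistance2? v w

  reaches₂ : ∀ {v u w} → v ⟶ u → u ⟶ w → v ≢ w → Reaches v w
  reaches₂ {v} {u} {w} v⟶u u⟶w v≢w with v ⟶? w
  ... | yes v⟶w = inj₁ v⟶w
  ... | no ¬v⟶w = inj₂ ((u , v⟶u , u⟶w) , v≢w , ¬v⟶w)

  ¬reaches-self : ∀ {v} → ¬ Reaches v v
  ¬reaches-self (inj₁ v⟶v)           = noLoop refl v⟶v
  ¬reaches-self (inj₂ (_ , v≢v , _)) = v≢v refl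

-- s ★ l reads: l is a leaf of the star with centre s.
record MissingStars {n} (D : OrientedGraph n) : Set₁ where
  open OrientedGraph D
  infix 4 _★_ _★?_
  field
    _★_             : Rel (Fin n) 0ℓ
    _★?_            : Decidable₂ _★_
    ★⇒missing       : ∀ {s l} → s ★ l → MissingEdge s l
    missing⇒★       : ∀ {u v} → MissingEdge u v → u ★ v ⊎ v ★ u
    centre-not-leaf : ∀ {s l t} → s ★ l → ¬ t ★ s
    centre-unique   : ∀ {s t l} → s ★ l → t ★ l → s ≡ t
    -- This field and the next hold what the directed triangle gives: from each centre, one other
    -- centre is one arc away and the remaining one two arcs away.
    centre-reaches  : ∀ {s l t m} → s ★ l → t ★ m → s ≢ t → Reaches D s t
    next-unique     : ∀ {s l t m r k} → s ★ l → t ★ m → r ★ k → s ⟶ t → s ⟶ r → t ≡ r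

-- Completion to a tournament.

module Completion {n} {D : OrientedGraph n} (stars : MissingStars D) where
  open OrientedGraph D
  open MissingStars stars

  infix 4 _⇒_ _⇒?_

  -- Makes a soft arc harmless as the second step of a path: after `v ⟶ s`, it leads only to
  -- vertices already in N[v].
  Convenient : Rel (Fin n) 0ℓ
  Convenient s l = ∀ v → v ⟶ s → Reaches D v l

  convenient? : Decidable₂ Convenient
  convenient? s l = all? λ v → (v ⟶? s) →-dec reaches? D v l

  -- Ties are broken against arcs from centre to leaf only, so the added arcs from leaf to centre
  -- are hard together with the arcs of `D`.
  Soft Hard _⇒_ : Rel (Fin n) 0ℓ
  Soft u v = u ★ v × Convenient u v
  Hard u v = u ⟶ v ⊎ (v ★ u × ¬ Convenient v u)
  u ⇒ v    = Hard u v ⊎ Soft u v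

  hard? : Decidable₂ Hard
  hard? u v = (u ⟶? v) ⊎-dec ((v ★? u) ×-dec ¬? (convenient? v u))

  _⇒?_ : Decidable₂ _⇒_
  u ⇒? v = hard? u v ⊎-dec ((u ★? v) ×-dec convenient? u v)

  soft⇒¬hard : ∀ {u v} → Soft u v → ¬ Hard u v
  soft⇒¬hard (u★v , _) (inj₁ u⟶v)       = proj₁ (proj₂ (★⇒missing u★v)) u⟶v
  soft⇒¬hard (u★v , _) (inj₂ (v★u , _)) = centre-not-leaf u★v v★u

  ⇒-asym : ∀ {u v} → u ⇒ v → ¬ v ⇒ u
  ⇒-asym (inj₁ (inj₁ u⟶v)) (inj₁ (inj₁ v⟶u))             = noDigon u⟶v v⟶u
  ⇒-asym (inj₁ (inj₁ u⟶v)) (inj₁ (inj₂ (u★v , _)))       = proj₁ (proj₂ (★⇒missing u★v)) u⟶v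
  ⇒-asym (inj₁ (inj₁ u⟶v)) (inj₂ (v★u , _))              = proj₂ (proj₂ (★⇒missing v★u)) u⟶v
  ⇒-asym (inj₁ (inj₂ (v★u , _))) (inj₁ (inj₁ v⟶u))       = proj₁ (proj₂ (★⇒missing v★u)) v⟶u
  ⇒-asym (inj₁ (inj₂ (v★u , _))) (inj₁ (inj₂ (u★v , _))) = centre-not-leaf u★v v★u
  ⇒-asym (inj₁ (inj₂ (_ , ¬conv))) (inj₂ (_ , conv))     = ¬conv conv
  ⇒-asym (inj₂ (_ , conv)) (inj₁ (inj₂ (_ , ¬conv)))     = ¬conv conv
  ⇒-asym (inj₂ (u★v , _)) (inj₁ (inj₁ v⟶u))              = proj₂ (proj₂ (★⇒missing u★v)) v⟶u
  ⇒-asym (inj₂ (u★v , _)) (inj₂ (v★u , _))               = centre-not-leaf u★v v★u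

  ★⇒comparable : ∀ {s l} → s ★ l → s ⇒ l ⊎ l ⇒ s
  ★⇒comparable {s} {l} s★l with convenient? s l
  ... | yes conv = inj₁ (inj₂ (s★l , conv))
  ... | no ¬conv = inj₂ (inj₁ (inj₂ (s★l , ¬conv)))

  ⇒-total : ∀ {u v} → u ≢ v → u ⇒ v ⊎ v ⇒ u
  ⇒-total {u} {v} u≢v with u ⟶? v | v ⟶? u
  ... | yes u⟶v | _       = inj₁ (inj₁ (inj₁ u⟶v))
  ... | no _    | yes v⟶u = inj₂ (inj₁ (inj₁ v⟶u))
  ... | no u↛v  | no v↛u with missing⇒★ (u≢v , u↛v , v↛u)
  ...   | inj₁ u★v = ★⇒comparable u★v
  ...   | inj₂ v★u = [ inj₂ , inj₁ ]′ (★⇒comparable v★u)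

  -- The missing edge between `f` and its centre loses to the missing edge between `u` and `v` in
  -- the dependency digraph.
  record Exceptional (f v u : Fin n) : Set where
    field
      centre     : Fin n
      centre★f   : centre ★ f
      v★u        : v ★ u
      centre⟶v   : centre ⟶ v
      f⟶u        : f ⟶ u
      ¬centre→→u : ¬ Reaches D centre u
      ¬f→→v      : ¬ Reaches D f v

  -- If v ★ u is inconvenient, the witness w of this fact is not adjacent to f, and f w loses to u v.
  dominates-or-exceptional : ∀ {f v u} → ¬ Reaches D f v → f ⟶ u → v ⇒ u ⊎ Exceptional f v u
  dominates-or-exceptional {f} {v} {u} ¬f→→v f⟶u with v ≟ f
  ... | yes refl = inj₁ (inj₁ (inj₁ f⟶u))
  ... | no v≢f with ⇒-total {v} {u} (λ { refl → ¬f→→v (inj₁ f⟶u) })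
  ...   | inj₁ v⇒u                            = inj₁ v⇒u
  ...   | inj₂ (inj₁ (inj₁ u⟶v))              = contradiction (reaches₂ D f⟶u u⟶v (≢-sym v≢f)) ¬f→→v
  ...   | inj₂ (inj₂ (_ , conv))              = contradiction (conv f f⟶u) ¬f→→v
  ...   | inj₂ (inj₁ (inj₂ (v★u , ¬conv)))
    with w , ¬imp ← ¬∀⟶∃¬ n _ (λ w → (w ⟶? v) →-dec reaches? D w u) ¬conv
    = exceptional
    where
    w⟶v : w ⟶ v
    w⟶v = decidable-stable (w ⟶? v) λ w↛v → ¬imp λ w⟶v → contradiction w⟶v w↛v

    ¬w→→u : ¬ Reaches D w u
    ¬w→→u r = ¬imp λ _ → r

    f≢w : f ≢ w
    f≢w refl = ¬f→→v (inj₁ w⟶v)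

    w≢u : w ≢ u
    w≢u refl = proj₂ (proj₂ (★⇒missing v★u)) w⟶v

    exceptional : v ⇒ u ⊎ Exceptional f v u
    exceptional with missing⇒★ (f≢w , (λ f⟶w → ¬f→→v (reaches₂ D f⟶w w⟶v (≢-sym v≢f)))
                                    , (λ w⟶f → ¬w→→u (reaches₂ D w⟶f f⟶u w≢u)))
    -- Here `f` and `v` would be distinct centres, and a centre reaches every other one.
    ... | inj₁ f★w = contradiction (centre-reaches f★w v★u (≢-sym v≢f)) ¬f→→v
    ... | inj₂ w★f = inj₂ record
      { centre★f = w★f ; v★u = v★u ; centre⟶v = w⟶v ; f⟶u = f⟶u ; ¬centre→→u = ¬w→→u ; ¬f→→v = ¬f→→v }

  module _ {a y b} (exc : Exceptional a y b) where
    open Exceptional exc renaming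
      ( centre to x; centre★f to x★a; v★u to y★b; centre⟶v to x⟶y
      ; f⟶u to a⟶b; ¬centre→→u to ¬x→→b; ¬f→→v to ¬a→→y )

    -- A leaf has one centre, and that centre has one successor among the centres.
    exceptional-unique : ∀ {v u} → Exceptional a v u → v ≡ y
    exceptional-unique exc′ with refl ← centre-unique (Exceptional.centre★f exc′) x★a =
      next-unique x★a (Exceptional.v★u exc′) y★b (Exceptional.centre⟶v exc′) x⟶y

    -- The path runs through `b`. As a leaf of `y`, it is adjacent to the other centre `x`, and
    -- `x ⟶ b` is excluded.
    leaf-reaches-centre : Reaches D a x
    leaf-reaches-centre = reaches₂ D a⟶b b⟶x (≢-sym (proj₁ (★⇒missing x★a)))
      where
      b≢x : b ≢ x
      b≢x refl = centre-not-leaf x★a y★b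

      b⟶x : b ⟶ x
      b⟶x = decidable-stable (b ⟶? x) λ b↛x →
        [ (λ b★x → centre-not-leaf b★x y★b)
        , (λ x★b → noLoop (centre-unique x★b y★b) x⟶y)
        ]′ (missing⇒★ (b≢x , b↛x , ¬x→→b ∘ inj₁))

    -- If `x ⟶ w`, then `b ⟶ w` would put `w` in N[a] and `w ⟶ b` would put `b` in N[x]. So `w` and
    -- `b` form a missing edge, but the only centre of `b` is `y`.
    centre↛ : ∀ {w} → ¬ Reaches D a w → w ≢ y → ¬ x ⟶ w
    centre↛ {w} ¬a→→w w≢y x⟶w =
      [ (λ b★w → centre-not-leaf b★w y★b)
      , (λ w★b → w≢y (centre-unique w★b y★b))
      ]′ (missing⇒★ ((λ { refl → ¬a→→w (inj₁ a⟶b) }) , b↛w , w↛b))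
      where
      b↛w : ¬ b ⟶ w
      b↛w b⟶w = ¬a→→w (reaches₂ D a⟶b b⟶w λ { refl → proj₁ (proj₂ (★⇒missing x★a)) x⟶w })
      w↛b : ¬ w ⟶ b
      w↛b w⟶b = ¬x→→b (reaches₂ D x⟶w w⟶b λ { refl → centre-not-leaf x★a y★b })

    -- An arc of the tournament from `x` to `w` must be soft: `centre↛` excludes arcs of `D`, and
    -- `x` is not a leaf.
    dominates-centre-or-soft : ∀ {w} → ¬ Reaches D a w → w ≢ y → w ⇒ x ⊎ Soft x w
    dominates-centre-or-soft {w} ¬a→→w w≢y
      with ⇒-total {w} {x} (λ { refl → ¬a→→w leaf-reaches-centre })
    ... | inj₁ w⇒x                      = inj₁ w⇒x
    ... | inj₂ (inj₁ (inj₁ x⟶w))        = contradiction x⟶w (centre↛ ¬a→→w w≢y)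
    ... | inj₂ (inj₁ (inj₂ (w★x , _)))  = contradiction w★x (centre-not-leaf x★a)
    ... | inj₂ (inj₂ soft)              = inj₂ soft

  -- Lexicographic: first the number of forward arcs of the tournament ⇒, then that of hard ones.
  weight : Fin n → Fin n → ℕ
  weight u v = suc n * 𝟙 (u ⇒? v) + 𝟙 (hard? u v)

  open MedianOrder weight

  -- Counting in the blocks of a median order.

  module _ {L} (L↭V : L ↭ allFin n) (median : LocallyMedian L) where

    module Block P B v Q (split : P ++ B ++ v ∷ Q ≡ L) where
      open ≤-Reasoning

      out into hardOut hardInto : Fin n → ℕ
      out      u = 𝟙 (v ⇒? u)
      into     u = 𝟙 (u ⇒? v)
      hardOut  u = 𝟙 (hard? v u)
      hardInto u = 𝟙 (hard? u v)

      Σ-block≤ : ∀ h → Σ[ h ] B ≤ Σ[ h ] L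
      Σ-block≤ h = begin
        Σ[ h ] B                               ≤⟨ m≤m+n _ _ ⟩
        Σ[ h ] B + Σ[ h ] (v ∷ Q)              ≡⟨ Σ-++ h B (v ∷ Q) ⟨
        Σ[ h ] (B ++ v ∷ Q)                    ≤⟨ m≤n+m _ _ ⟩
        Σ[ h ] P + Σ[ h ] (B ++ v ∷ Q)         ≡⟨ Σ-++ h P (B ++ v ∷ Q) ⟨
        Σ[ h ] (P ++ B ++ v ∷ Q)               ≡⟨ cong Σ[ h ] split ⟩
        Σ[ h ] L                               ∎

      length≤n : length B ≤ n
      length≤n = begin
        length B                                 ≤⟨ m≤m+n _ _ ⟩
        length B + length (v ∷ Q)                ≡⟨ length-++ B ⟨
        length (B ++ v ∷ Q)                      ≤⟨ m≤n+m _ (length P) ⟩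
        length P + length (B ++ v ∷ Q)           ≡⟨ length-++ P ⟨
        length (P ++ B ++ v ∷ Q)                 ≡⟨ cong length split ⟩
        length L                                 ≡⟨ ↭-length L↭V ⟩
        length (allFin n)                        ≡⟨ length-tabulate id ⟩
        n                                        ∎

      -- The feedback property of median orders, with the two components of `weight` summed
      -- separately.
      feedback : suc n * Σ[ out ] B + Σ[ hardOut ] B ≤ suc n * Σ[ into ] B + Σ[ hardInto ] B
      feedback = subst₂ _≤_ (Σ-weight out hardOut) (Σ-weight into hardInto) (median P B v Q split)
        where
        Σ-weight : ∀ f g → Σ[ (λ u → suc n * f u + g u) ] B ≡ suc n * Σ[ f ] B + Σ[ g ] B
        Σ-weight f g = trans (Σ-+ (λ u → suc n * f u) g B) (cong (_+ Σ[ g ] B) (Σ-* (suc n) f B))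

      out≤into : Σ[ out ] B ≤ Σ[ into ] B
      -- The hard arcs of a block contribute at most `n`, less than the factor `suc n`, and cannot
      -- make up for a deficit of one in the main term.
      out≤into = ≮⇒≥ λ into<out → <-irrefl refl (+-cancelˡ-< (suc n * Σ[ into ] B) _ _ (begin-strict
        suc n * Σ[ into ] B + n                      <⟨ +-monoʳ-< (suc n * Σ[ into ] B) (n<1+n n) ⟩
        suc n * Σ[ into ] B + suc n                  ≡⟨ +-comm (suc n * Σ[ into ] B) (suc n) ⟩
        suc n + suc n * Σ[ into ] B                  ≡⟨ *-suc (suc n) (Σ[ into ] B) ⟨
        suc n * suc (Σ[ into ] B)                    ≤⟨ *-monoʳ-≤ (suc n) into<out ⟩
        suc n * Σ[ out ] B                           ≤⟨ m≤m+n _ _ ⟩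
        suc n * Σ[ out ] B + Σ[ hardOut ] B          ≤⟨ feedback ⟩
        suc n * Σ[ into ] B + Σ[ hardInto ] B        ≤⟨ +-monoʳ-≤ (suc n * Σ[ into ] B) (≤-trans
                                                          (Σ-≤length B λ u → 𝟙≤1 (hard? u v)) length≤n) ⟩
        suc n * Σ[ into ] B + n                      ∎))

      out+into≤length : Σ[ out ] B + Σ[ into ] B ≤ length B
      out+into≤length = begin
        Σ[ out ] B + Σ[ into ] B             ≡⟨ Σ-+ out into B ⟨
        Σ[ (λ u → out u + into u) ] B        ≤⟨ Σ-≤length B (λ u → 𝟙-exclusive (v ⇒? u) (u ⇒? v) ⇒-asym) ⟩
        length B                             ∎

      -- A leaf v has no soft arc to the block, so at a tie it would be moved before its centre.
      soft-slack : ∀ {x} → Soft x v → Σ[ out ] B + Σ[ (λ u → 𝟙 (x ≟ u)) ] B ≤ Σ[ into ] B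
      -- All arcs out of `v` are hard, hence counted `suc (suc n)` times. The soft arc from `x`, if
      -- `x` is in `B`, is counted only `suc n` times, which leaves room for `δ`.
      soft-slack {x} soft = cancel (Σ[ δ ] B) δ≤1 (begin
        suc (suc n) * Σ[ out ] B + Σ[ δ ] B                   ≡⟨ regroup n (Σ[ out ] B) _ ⟩
        suc n * Σ[ out ] B + Σ[ out ] B + Σ[ δ ] B            ≤⟨ +-monoˡ-≤ (Σ[ δ ] B) (+-monoʳ-≤ (suc n * Σ[ out ] B)
                                                                   (Σ-mono B out≤hardOut)) ⟩
        suc n * Σ[ out ] B + Σ[ hardOut ] B + Σ[ δ ] B        ≤⟨ +-monoˡ-≤ (Σ[ δ ] B) feedback ⟩
        suc n * Σ[ into ] B + Σ[ hardInto ] B + Σ[ δ ] B      ≡⟨ +-assoc (suc n * Σ[ into ] B) _ _ ⟩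
        suc n * Σ[ into ] B + (Σ[ hardInto ] B + Σ[ δ ] B)    ≡⟨ cong (suc n * Σ[ into ] B +_) (Σ-+ hardInto δ B) ⟨
        suc n * Σ[ into ] B + Σ[ (λ u → hardInto u + δ u) ] B ≤⟨ +-monoʳ-≤ (suc n * Σ[ into ] B)
                                                                   (Σ-mono B hardInto+δ≤into) ⟩
        suc n * Σ[ into ] B + Σ[ into ] B                     ≡⟨ +-comm (suc n * Σ[ into ] B) _ ⟩
        suc (suc n) * Σ[ into ] B                             ∎)
        where
        δ : Fin n → ℕ
        δ u = 𝟙 (x ≟ u)

        δ≤1 : Σ[ δ ] B ≤ 1
        δ≤1 = ≤-trans (Σ-block≤ δ) (≤-reflexive (trans (Σ-↭ δ L↭V) (Σ-indicator x)))

        out≤hardOut : ∀ u → out u ≤ hardOut u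
        out≤hardOut u = 𝟙-mono (v ⇒? u) (hard? v u)
          [ id , (λ (v★u , _) → contradiction (proj₁ soft) (centre-not-leaf v★u)) ]′

        hardInto+δ≤into : ∀ u → hardInto u + δ u ≤ into u
        hardInto+δ≤into u = 𝟙-exclusive-mono (hard? u v) (x ≟ u) (u ⇒? v)
          inj₁ (λ { refl → inj₂ soft }) (λ { hard refl → soft⇒¬hard soft hard })

        regroup : ∀ n o d → suc (suc n) * o + d ≡ suc n * o + o + d
        regroup = solve-∀

        cancel : ∀ {a b} d → d ≤ 1 → suc (suc n) * a + d ≤ suc (suc n) * b → a + d ≤ b
        cancel {a} {b} 0 _ le = subst (_≤ b) (sym (+-identityʳ a))
          (*-cancelˡ-≤ (suc (suc n)) (subst (_≤ suc (suc n) * b) (+-identityʳ _) le))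
        -- The inequality is strict without the summand 1, and strictness survives the division.
        cancel {a} {b} 1 _ le = subst (_≤ b) (+-comm 1 a)
          (*-cancelˡ-< (suc (suc n)) a b (subst (_≤ suc (suc n) * b) (+-comm _ 1) le))
        cancel (suc (suc _)) (s≤s ()) _

    -- Degrees of the last vertex.

    module _ (f : Fin n) where

      private
        o r : Fin n → ℕ
        o u = 𝟙 (f ⟶? u)
        r u = 𝟙 (atDistance2? f u)

      -- Out-neighbours of `f` are counted twice, against `out` and against `into`, which together
      -- fit in the length of the block. Summed over the blocks, this gives 2o + s ≤ o + r + t. The
      -- corrections `s` and `t` have equal totals and cancel with one `o`.
      degree-bound : ∀ {L′} → L ≡ L′ ∷ʳ f → {Pivot : Pred (Fin n) 0ℓ} (Pivot? : Decidable Pivot)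
        (s t : Fin n → ℕ) →
        Pivot f →
        (∀ v → Pivot v → ¬ f ⟶ v × s v ≡ 0) →
        (∀ u → ¬ Pivot u → Reaches D f u ⊎ 1 ≤ t u) →
        Σ[ t ] L ≡ Σ[ s ] L →
        (∀ P B v Q (split : P ++ B ++ v ∷ Q ≡ L) → Pivot v →
          Σ[ o ] B + (Σ[ o ] B + Σ[ s ] B) ≤
            Σ[ Block.out P B v Q split ] B + Σ[ Block.into P B v Q split ] B) →
        d⁺ f ≤ d⁺⁺ f
      degree-bound {L′} refl {Pivot} Pivot? s t pf pivot nonpivot Σt≡Σs block = begin
        d⁺ f        ≡⟨ trans (∣subset∣ (f ⟶?_)) (sym (Σ-↭ o L↭V)) ⟩
        Σ[ o ] L    ≤⟨ +-cancelˡ-≤ (Σ[ o ] L + Σ[ s ] L) _ _ doubled ⟩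
        Σ[ r ] L    ≡⟨ trans (Σ-↭ r L↭V) (sym (∣subset∣ (atDistance2? f))) ⟩
        d⁺⁺ f       ∎
        where
        open ≤-Reasoning

        h m : Fin n → ℕ
        h u = o u + (o u + s u)
        m u = o u + (r u + t u)

        Σ-triple : ∀ a b c xs → Σ[ (λ u → a u + (b u + c u)) ] xs ≡ Σ[ a ] xs + (Σ[ b ] xs + Σ[ c ] xs)
        Σ-triple a b c xs = trans (Σ-+ a (λ u → b u + c u) xs) (cong (Σ[ a ] xs +_) (Σ-+ b c xs))

        h-pivot : ∀ v → Pivot v → h v ≡ 0
        h-pivot v pv with f↛v , sv≡0 ← pivot v pv rewrite 𝟙-no (f ⟶? v) f↛v = sv≡0

        m-nonpivot : ∀ u → ¬ Pivot u → 1 ≤ m u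
        m-nonpivot u ¬pu with nonpivot u ¬pu
        ... | inj₁ (inj₁ f⟶u) = ≤-trans (𝟙-yes (f ⟶? u) f⟶u) (m≤m+n _ _)
        ... | inj₁ (inj₂ at2) = ≤-trans (𝟙-yes (atDistance2? f u) at2) (≤-trans (m≤m+n _ (t u)) (m≤n+m _ (o u)))
        ... | inj₂ 1≤t        = ≤-trans 1≤t (≤-trans (m≤n+m _ (r u)) (m≤n+m _ (o u)))

        h-block : ∀ P B v Q → P ++ B ++ v ∷ Q ≡ L → Pivot v → Σ[ h ] B ≤ length B
        h-block P B v Q split pv = ≤-trans (≤-reflexive (Σ-triple o o s B))
          (≤-trans (block P B v Q split pv) (Block.out+into≤length P B v Q split))

        swap : ∀ a b c → a + (b + c) ≡ a + c + b
        swap = solve-∀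

        doubled : Σ[ o ] L + Σ[ s ] L + Σ[ o ] L ≤ Σ[ o ] L + Σ[ s ] L + Σ[ r ] L
        doubled = begin
          Σ[ o ] L + Σ[ s ] L + Σ[ o ] L     ≡⟨ swap (Σ[ o ] L) (Σ[ o ] L) _ ⟨
          Σ[ o ] L + (Σ[ o ] L + Σ[ s ] L)   ≡⟨ Σ-triple o o s L ⟨
          Σ[ h ] L                           ≤⟨ Σ-blocks Pivot? h m h-pivot m-nonpivot L′ f pf h-block ⟩
          Σ[ m ] L                           ≡⟨ Σ-triple o r t L ⟩
          Σ[ o ] L + (Σ[ r ] L + Σ[ t ] L)   ≡⟨ cong (λ k → Σ[ o ] L + (Σ[ r ] L + k)) Σt≡Σs ⟩
          Σ[ o ] L + (Σ[ r ] L + Σ[ s ] L)   ≡⟨ swap (Σ[ o ] L) _ _ ⟩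
          Σ[ o ] L + Σ[ s ] L + Σ[ r ] L     ∎

      -- With zero corrections, domination gives o ≤ `out`, and the median order gives `out` ≤
      -- `into`.
      ordinary-feed : ∀ {L′} → L ≡ L′ ∷ʳ f → (∀ v u → ¬ Reaches D f v → f ⟶ u → v ⇒ u) → d⁺ f ≤ d⁺⁺ f
      ordinary-feed eq dominates = degree-bound eq (¬? ∘ reaches? D f) (λ _ → 0) (λ _ → 0)
        (¬reaches-self D)
        (λ v ¬f→→v → ¬f→→v ∘ inj₁ , refl)
        (λ u ¬¬f→→u → inj₁ (decidable-stable (reaches? D f u) ¬¬f→→u))
        refl
        (λ P B v Q split ¬f→→v → let
            open Block P B v Q split
            o≤out = Σ-mono B λ u → 𝟙-mono (f ⟶? u) (v ⇒? u) (dominates v u ¬f→→v)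
            o+0≤out = ≤-trans (≤-reflexive (sym (Σ-+ o (λ _ → 0) B)))
              (≤-trans (Σ-mono B λ u → ≤-reflexive (+-identityʳ (o u))) o≤out)
          in +-mono-≤ o≤out (≤-trans o+0≤out out≤into))

      -- `y` is struck from the pivots: `δy` makes it count within its block, and `δx` charges this
      -- to the block of `x`.
      exceptional-feed : ∀ {L′ y b} → L ≡ L′ ∷ʳ f → Exceptional f y b → d⁺ f ≤ d⁺⁺ f
      exceptional-feed {y = y} eq exc = degree-bound eq
        (λ v → ¬? (reaches? D f v) ×-dec ¬? (v ≟ y)) δx δy
        (¬reaches-self D , λ { refl → centre-not-leaf v★u centre★f })
        -- `x` lies in N[f], so it is no pivot and its charge falls inside a block.
        (λ v (¬f→→v , _) → ¬f→→v ∘ inj₁ , 𝟙-no (x ≟ v) λ { refl → ¬f→→v (leaf-reaches-centre exc) })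
        nonpivot
        (trans (Σ-one y) (sym (Σ-one x)))
        block
        where
        open Exceptional exc renaming (centre to x)

        δx δy : Fin n → ℕ
        δx u = 𝟙 (x ≟ u)
        δy u = 𝟙 (y ≟ u)

        Σ-one : ∀ z → Σ[ (λ u → 𝟙 (z ≟ u)) ] L ≡ 1
        Σ-one z = trans (Σ-↭ (λ u → 𝟙 (z ≟ u)) L↭V) (Σ-indicator z)

        nonpivot : ∀ u → ¬ (¬ Reaches D f u × u ≢ y) → Reaches D f u ⊎ 1 ≤ δy u
        nonpivot u ¬pu with reaches? D f u
        ... | yes f→→u = inj₁ f→→u
        ... | no ¬f→→u = inj₂ (𝟙-yes (y ≟ u) (sym (decidable-stable (u ≟ y) λ u≢y → ¬pu (¬f→→u , u≢y))))

        block : ∀ P B v Q (split : P ++ B ++ v ∷ Q ≡ L) → ¬ Reaches D f v × v ≢ y →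
          Σ[ o ] B + (Σ[ o ] B + Σ[ δx ] B) ≤
            Σ[ Block.out P B v Q split ] B + Σ[ Block.into P B v Q split ] B
        block P B v Q split (¬f→→v , v≢y) =
          -- If `v ⇒ x`, the charge is paid within `out`, as `x` is not an out-neighbour of `f`. In
          -- the soft case, it is paid by the gap between `out` and `into`.
          [ (λ v⇒x → +-mono-≤ o≤out (≤-trans (≤-reflexive (sym (Σ-+ o δx B)))
              (≤-trans (Σ-mono B λ u → 𝟙-exclusive-mono (f ⟶? u) (x ≟ u) (v ⇒? u)
                  dominates (λ { refl → v⇒x }) (λ { f⟶x refl → proj₂ (proj₂ (★⇒missing centre★f)) f⟶x }))
                out≤into)))
          , (λ soft → +-mono-≤ o≤out (≤-trans (+-monoˡ-≤ (Σ[ δx ] B) o≤out) (soft-slack soft)))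
          ]′ (dominates-centre-or-soft exc ¬f→→v v≢y)
          where
          open Block P B v Q split

          dominates : ∀ {u} → f ⟶ u → v ⇒ u
          dominates f⟶u = [ id , (λ exc′ → contradiction (exceptional-unique exc exc′) v≢y) ]′
            (dominates-or-exceptional ¬f→→v f⟶u)

          o≤out : Σ[ o ] B ≤ Σ[ out ] B
          o≤out = Σ-mono B λ u → 𝟙-mono (f ⟶? u) (v ⇒? u) dominates

      feed-bound : ∀ {L′} → L ≡ L′ ∷ʳ f → d⁺ f ≤ d⁺⁺ f
      feed-bound eq
        with any? (λ v → any? λ u → ¬? (reaches? D f v) ×-dec (f ⟶? u) ×-dec ¬? (v ⇒? u))
      ... | yes (v , u , ¬f→→v , f⟶u , ¬v⇒u) =
            [ (λ v⇒u → contradiction v⇒u ¬v⇒u) , exceptional-feed eq ]′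
              (dominates-or-exceptional ¬f→→v f⟶u)
      ... | no none = ordinary-feed eq λ v u ¬f→→v f⟶u →
            decidable-stable (v ⇒? u) λ ¬v⇒u → none (v , u , ¬f→→v , f⟶u , ¬v⇒u)

  -- The given vertex guarantees that the order has a last element.
  satisfiesSNC : Fin n → SatisfiesSNC D
  satisfiesSNC x = decidable-stable (any? λ v → d⁺ v ≤? d⁺⁺ v) λ ¬snc →
    ¬¬locallyMedian (allFin n) λ (L , L↭V , median) → last ¬snc L L↭V median (initLast L)
    where
    last : ¬ SatisfiesSNC D → ∀ L → L ↭ allFin n → LocallyMedian L → ¬ InitLast L
    last ¬snc .[] L↭V median [] with () ← ∈-resp-↭ (↭-sym L↭V) (∈-allFin x)
    last ¬snc .(L ∷ʳ f) L↭V median (L ∷ʳ′ f) = ¬snc (f , feed-bound L↭V median f refl)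

-- Stars whose centres form a directed triangle.

module CyclicStars {n} (D : OrientedGraph n) (star : Fin 3 → Star n) (next : Fin 3 → Fin 3) where
  open OrientedGraph D
  open Star
  open Graph

  -- Indexing by `Fin 3` with an abstract successor `next` treats both directions of the triangle at
  -- once. `exhausts` and `next³` can then be decided by evaluation.
  record IsCyclic : Set where
    field
      disjoint  : ∀ {i j} → i ≢ j → VertexDisjoint (graph (star i)) (graph (star j))
      missing⇒  : ∀ {u v} → MissingEdge u v → ∃[ i ] E (graph (star i)) u v
      missing⇐  : ∀ {u v} i → E (graph (star i)) u v → MissingEdge u v
      arc       : ∀ i → centre (star i) ⟶ centre (star (next i))
      exhausts  : ∀ i j → i ≢ j → j ≡ next i ⊎ j ≡ next (next i)
      next³     : ∀ i → next (next (next i)) ≡ i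

  missingStars : IsCyclic → MissingStars D
  missingStars cyclic = record
    { _★_             = _★_
    ; _★?_            = λ s l → any? λ i → (s ≟ centre (star i)) ×-dec (l ∈? leaves (star i))
    ; ★⇒missing       = λ (i , s≡c , l∈) → missing⇐ i (inj₂ (l∈ , s≡c))
    ; missing⇒★       = λ uv → [ (λ (u∈ , v≡c) → inj₂ (_ , v≡c , u∈))
                               , (λ (v∈ , u≡c) → inj₁ (_ , u≡c , v∈)) ]′ (proj₂ (missing⇒ uv))
    ; centre-not-leaf = centre-not-leaf
    ; centre-unique   = centre-unique
    ; centre-reaches  = centre-reaches
    ; next-unique     = next-unique
    }
    where
    open IsCyclic cyclic

    _★_ : Rel (Fin n) 0ℓ
    s ★ l = ∃[ i ] (s ≡ centre (star i) × l ∈ leaves (star i))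

    common-vertex : ∀ {v} i j → V (graph (star i)) v → V (graph (star j)) v → i ≡ j
    common-vertex i j vi vj = decidable-stable (i ≟ j) λ i≢j → disjoint i≢j (vi , vj)

    centre-not-leaf : ∀ {s l t} → s ★ l → ¬ t ★ s
    centre-not-leaf (i , s≡c , _) (j , _ , s∈) with refl ← common-vertex i j (inj₁ s≡c) (inj₂ s∈) =
      centre∉leaves (star i) (subst (_∈ leaves (star i)) s≡c s∈)

    centre-unique : ∀ {s t l} → s ★ l → t ★ l → s ≡ t
    centre-unique (i , refl , l∈i) (j , refl , l∈j) =
      cong (centre ∘ star) (common-vertex i j (inj₂ l∈i) (inj₂ l∈j))

    centre-reaches : ∀ {s l t m} → s ★ l → t ★ m → s ≢ t → Reaches D s t
    centre-reaches (i , refl , _) (j , refl , _) s≢t with exhausts i j (λ { refl → s≢t refl })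
    ... | inj₁ refl = inj₁ (arc i)
    ... | inj₂ refl = reaches₂ D (arc i) (arc (next i)) s≢t

    -- The other candidate, `next (next i)`, has an arc to `i`, which would close a digon.
    out-arc : ∀ i j → centre (star i) ⟶ centre (star j) → j ≡ next i
    out-arc i j i⟶j with exhausts i j (λ { refl → noLoop refl i⟶j })
    ... | inj₁ j≡next = j≡next
    ... | inj₂ refl   = contradiction
      (subst (λ k → centre (star (next (next i))) ⟶ centre (star k)) (next³ i) (arc (next (next i))))
      (noDigon i⟶j)

    next-unique : ∀ {s l t m r k} → s ★ l → t ★ m → r ★ k → s ⟶ t → s ⟶ r → t ≡ r
    next-unique (i , refl , _) (j , refl , _) (k , refl , _) s⟶t s⟶r =
      cong (centre ∘ star) (trans (out-arc i j s⟶t) (sym (out-arc i k s⟶r)))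

missingStars-triangle : ∀ {n} {D : OrientedGraph n} {S T U : Star n} → MissingDisjointStars D S T U →
  DirectedTriangle D (Star.centre S) (Star.centre T) (Star.centre U) → MissingStars D
missingStars-triangle {n} {D} {S} {T} {U} missing (_ , _ , _ , orientation) =
  [ (λ (_ , cycle⇒arc) → CyclicStars.missingStars D star forward record
      { disjoint = disjoint ; missing⇒ = missing⇒ ; missing⇐ = missing⇐
      ; arc      = λ { 0F → arc (cycle⇒arc (inj₁ (refl , refl)))
                     ; 1F → arc (cycle⇒arc (inj₂ (inj₁ (refl , refl))))
                     ; 2F → arc (cycle⇒arc (inj₂ (inj₂ (refl , refl)))) }
      ; exhausts = from-yes (exhausts? forward)
      ; next³    = from-yes (next³? forward) })
  , (λ (_ , cycle⇒arc) → CyclicStars.missingStars D star backward record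
      { disjoint = disjoint ; missing⇒ = missing⇒ ; missing⇐ = missing⇐
      -- `Cycle₃ x z y` lists the arc leaving `z` second and the one leaving `y` third, so indices 1
      -- and 2 trade places.
      ; arc      = λ { 0F → arc (cycle⇒arc (inj₁ (refl , refl)))
                     ; 1F → arc (cycle⇒arc (inj₂ (inj₂ (refl , refl))))
                     ; 2F → arc (cycle⇒arc (inj₂ (inj₁ (refl , refl)))) }
      ; exhausts = from-yes (exhausts? backward)
      ; next³    = from-yes (next³? backward) })
  ]′ orientation
  where
  open OrientedGraph D
  open MissingDisjointStars missing
  open Graph

  star : Fin 3 → Star n
  star 0F = S
  star 1F = T
  star 2F = U

  forward backward : Fin 3 → Fin 3
  forward 0F = 1F
  forward 1F = 2F
  forward 2F = 0F
  backward 0F = 2F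
  backward 1F = 0F
  backward 2F = 1F

  exhausts? : ∀ next → Dec (∀ i j → i ≢ j → j ≡ next i ⊎ j ≡ next (next i))
  exhausts? next = all? λ i → all? λ j →
    ¬? (i ≟ j) →-dec ((j ≟ next i) ⊎-dec (j ≟ next (next i)))

  next³? : ∀ next → Dec (∀ i → next (next (next i)) ≡ i)
  next³? next = all? λ i → next (next (next i)) ≟ i

  arc : ∀ {A u v} → Induced D A u v → u ⟶ v
  arc (_ , _ , u⟶v) = u⟶v

  disjoint : ∀ {i j} → i ≢ j → VertexDisjoint (Star.graph (star i)) (Star.graph (star j))
  disjoint {0F} {0F} i≢j _       = i≢j refl
  disjoint {0F} {1F} _           = S⊥T
  disjoint {0F} {2F} _           = S⊥U
  disjoint {1F} {0F} _ (vT , vS) = S⊥T (vS , vT)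
  disjoint {1F} {1F} i≢j _       = i≢j refl
  disjoint {1F} {2F} _           = T⊥U
  disjoint {2F} {0F} _ (vU , vS) = S⊥U (vS , vU)
  disjoint {2F} {1F} _ (vU , vT) = T⊥U (vT , vU)
  disjoint {2F} {2F} i≢j _       = i≢j refl

  missing⇒ : ∀ {u v} → MissingEdge u v → ∃[ i ] E (Star.graph (star i)) u v
  missing⇒ uv with proj₁ (proj₂ union) uv
  ... | inj₁ e        = 0F , e
  ... | inj₂ (inj₁ e) = 1F , e
  ... | inj₂ (inj₂ e) = 2F , e

  missing⇐ : ∀ {u v} i → E (Star.graph (star i)) u v → MissingEdge u v
  missing⇐ 0F e = proj₂ (proj₂ union) (inj₁ e)
  missing⇐ 1F e = proj₂ (proj₂ union) (inj₂ (inj₁ e))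
  missing⇐ 2F e = proj₂ (proj₂ union) (inj₂ (inj₂ e))

theorem6 : ∀ (n : ℕ) (D : OrientedGraph n) (S T U : Star n) →
    MissingDisjointStars D S T U →
    DirectedTriangle D (Star.centre S) (Star.centre T) (Star.centre U) →
    (∀ e → ¬ Isolated (Δ D) e) →
    SatisfiesSNC D
theorem6 n D S T U missing triangle _ =
  Completion.satisfiesSNC (missingStars-triangle missing triangle) (Star.centre S)
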